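{- Let $h$ be a totally ordered complete (well-formed) history and let $\mathbb{S}=(\Sigma,\mathit{legal})$ be a sequential object or an object family. Then $h$ is linearizable with respect to $\mathbb{S}$ if and only if $\mathit{exec}(h)$ is causally linearizable with respect to $\mathbb{S}$.
   Context: Sequential objects. Let $\mathit{Inv}$ and $\mathit{Res}$ be sets of invocations and responses (including input and return values). A sequential object is a pair $\mathbb{S}=(\Sigma,\mathit{legal})$ with $\Sigma=\mathit{Inv}\times\mathit{Res}$ the set of labels and $\mathit{legal}\subseteq\Sigma^*$ prefix-closed. Its conflict relation is: $o\,\#\,o'$ iff it is not the case that for all $k_1,k_2\in\Sigma^*$, $k_1oo'k_2\in\mathit{legal}\Leftrightarrow k_1o'ok_2\in\mathit{legal}$. An object family over an index set $X$, built from sequential objects $(\Sigma_x,\mathit{legal}_x)$ with pairwise disjoint $\Sigma_x$, is the pair $(\Sigma_X,\mathit{legal}_X)$ with $\Sigma_X=\bigcup_x\Sigma_x$ and $\mathit{legal}_X=\{k\in\Sigma_X^*\mid\forall x.\ k{\downharpoonright}x\in\mathit{legal}_x\}$, where $k{\downharpoonright}x$ restricts $k$ to labels in $\Sigma_x$; it is treated as a pair $(\Sigma,\mathit{legal})$ as well. Histories. A history $h$ is a (finite) relation ordering invocation and response events; each such event is a unique occurrence carrying a process identifier and an invocation or response label. A history is well-formed if it is a partial order and its restriction $h{\downharpoonright}p$ to each process $p$ is a total order consisting of invocations each followed by its matching response. It is complete if every invocation has a matching response. $mp(h)$ is the set of matching pairs $(i,r)$ of invocations and responses in $h$. A history is sequential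 if it is totally ordered and each invocation is immediately followed by its matching response. For a sequential history $\mathit{hs}$, $\gamma(\mathit{hs})$ is the sequence of operations (matching pairs) of $\mathit{hs}$ in the same order as in $\mathit{hs}$: for $(i,r),(i',r')\in mp(\mathit{hs})$, $(r,i')\in\mathit{hs}$ iff $(i,r)$ precedes $(i',r')$ in $\gamma(\mathit{hs})$. A sequence of operations is legal iff its sequence of labels is in $\mathit{legal}$. Linearizability. A complete history $h$ is linearizable w.r.t. $\mathbb{S}$ iff there is a sequential history $\mathit{hs}$ such that $\gamma(\mathit{hs})\in\mathit{legal}$, for each process $p$, $h{\downharpoonright}p=\mathit{hs}{\downharpoonright}p$, and $\mathit{hs}$ preserves the real-time order of $h$: for all $(i_1,r_1),(i_2,r_2)\in mp(h)$, if $(r_1,i_2)\in h$ then $(r_1,i_2)\in\mathit{hs}$. From histories to execution structures. For a well-formed history $h$, $\mathit{exec}(h)=(E,\rightarrow,\dashrightarrow)$ with $E=mp(h)$, $\rightarrow\,=\{((i_1,r_1),(i_2,r_2))\in E\times E\mid(r_1,i_2)\in h\}$, and $\dashrightarrow\,=\{((i_1,r_1),(i_2,r_2))\in E\times E\mid(i_1,r_2)\in h\}$. Each element of $E$ is regarded as an event, i.e. a unique occurrence with a process identifier and a label in $\Sigma$. Causal linearizability. For a finite sequence $k$ of events (each occurring at most once), $\mathit{ev}(k)$ is its set of events, $e\twoheadrightarrow_k e'$ iff $e$ occurs before $e'$ in $k$, and $e\prec_k e'$ iff $e\twoheadrightarrow_k e'$ and the labels of $e$ and $e'$ conflict ($\#$).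 $(E,\rightarrow,\dashrightarrow)$ is causally linearizable w.r.t. $\mathbb{S}$ if there is a legal sequence of events $k$ with $\mathit{ev}(k)=E$, $\rightarrow\,\subseteq\,\twoheadrightarrow_k$ and $\prec_k\,\subseteq\,\dashrightarrow$. -}

module Defs where

open import Level using (0ℓ)
open import Data.List using (List; []; _∷_; _++_; map)
open import Data.List.Membership.Propositional using () renaming (_∈_ to _∈ₗ_)
open import Data.List.Relation.Binary.Sublist.Propositional using () renaming (_⊆_ to _⊑_)
open import Data.List.Relation.Unary.All using (All)
open import Data.List.Relation.Unary.Unique.Propositional using (Unique)
open import Data.Product using (∃-syntax; _×_; _,_; proj₁; proj₂)
open import Data.Sum using (_⊎_; inj₁; inj₂; [_,_]′)
open import Function.Bundles using (_⇔_)
open import Relation.Binary using (Rel; IsStrictPartialOrder)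
open import Relation.Binary.PropositionalEquality using (_≡_; _≢_)
open import Relation.Nullary using (¬_)
open import Relation.Unary using (Pred; _∈_; _∉_; _⟨×⟩_; _≐_; Empty; _∩_)

-- Inv and Res are ambient sets of invocations and responses.  The label sets
-- of the individual objects are subsets of Inv × Res, so that unions of
-- label sets (and their disjointness) are literal.

record Object (Inv Res : Set) : Set₁ where
  field
    labels : Pred (Inv × Res) 0ℓ
    legal  : Pred (List (Inv × Res)) 0ℓ

  Conflict : Rel (Inv × Res) 0ℓ
  Conflict o o' = o ∈ labels × o' ∈ labels × ¬ (∀ k₁ k₂ →
    All labels k₁ → All labels k₂ →
    legal (k₁ ++ o ∷ o' ∷ k₂) ⇔ legal (k₁ ++ o' ∷ o ∷ k₂))

record SequentialObject (Inv Res : Set) : Set₁ where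
  field
    invocations  : Pred Inv 0ℓ
    responses    : Pred Res 0ℓ

  labels : Pred (Inv × Res) 0ℓ
  labels = invocations ⟨×⟩ responses

  field
    legal        : Pred (List (Inv × Res)) 0ℓ
    legal⊆labels : ∀ {k} → legal k → All labels k
    prefixClosed : ∀ k k' → legal (k ++ k') → legal k

  object : Object Inv Res
  object = record { labels = labels ; legal = legal }

-- Restriction P k k' says that k' is k restricted to the elements in P.
-- For every k there is at most one such k'; the graph is used, rather than
-- `filter`, because membership in P is not assumed to be decidable.
data Restriction {A : Set} (P : Pred A 0ℓ) : List A → List A → Set where
  []   : Restriction P [] []
  keep : ∀ {x k k'} → x ∈ P → Restriction P k k' → Restriction P (x ∷ k) (x ∷ k')
  drop : ∀ {x k k'} → x ∉ P → Restriction P k k' → Restriction P (x ∷ k) k'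

record ObjectFamily (Inv Res : Set) : Set₁ where
  field
    Index  : Set
    member : Index → SequentialObject Inv Res

  module Member (x : Index) = SequentialObject (member x)

  field
    disjoint : ∀ {x y} → x ≢ y → Empty (Member.labels x ∩ Member.labels y)

  labels : Pred (Inv × Res) 0ℓ
  labels s = ∃[ x ] s ∈ Member.labels x

  legal : Pred (List (Inv × Res)) 0ℓ
  legal k = All labels k ×
    (∀ x → ∃[ k' ] Restriction (Member.labels x) k k' × Member.legal x k')

  object : Object Inv Res
  object = record { labels = labels ; legal = legal }

objectOf : ∀ {Inv Res} → SequentialObject Inv Res ⊎ ObjectFamily Inv Res → Object Inv Res
objectOf = [ SequentialObject.object , ObjectFamily.object ]′

-- Unique occurrences, each carrying a process identifier and a label.
record Occurrences (Proc Label : Set) : Set₁ where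
  field
    Carrier : Set
    proc    : Carrier → Proc
    label   : Carrier → Label

-- An operation is a pair of an invocation event and a response event.  Its
-- process is that of the invocation; in a matching pair (see `mp` below) the
-- response has the same one.
operations : ∀ {Proc Inv Res} →
  Occurrences Proc Inv → Occurrences Proc Res → Occurrences Proc (Inv × Res)
operations I R = record
  { Carrier = I.Carrier × R.Carrier
  ; proc    = λ (i , r) → I.proc i
  ; label   = λ (i , r) → I.label i , R.label r
  }
  where
  module I = Occurrences I
  module R = Occurrences R

Before : {A : Set} → List A → Rel A 0ℓ
Before k e e' = (e ∷ e' ∷ []) ⊑ k

record ExecutionStructure {Proc Label} (O : Occurrences Proc Label) : Set₁ where
  open Occurrences O
  field
    E   : Pred Carrier 0ℓ
    _⟶_ : Rel Carrier 0ℓ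
    _⇢_ : Rel Carrier 0ℓ

module _ {Proc Inv Res} (S : Object Inv Res) {O : Occurrences Proc (Inv × Res)} where
  open Object S
  open Occurrences O

  ConflictBefore : List Carrier → Rel Carrier 0ℓ
  ConflictBefore k e e' = Before k e e' × Conflict (label e) (label e')

  CausallyLinearizable : ExecutionStructure O → Set
  CausallyLinearizable X = ∃[ k ]
      Unique k
    × legal (map label k)
    × (∀ e → e ∈ₗ k ⇔ e ∈ E)
    × (∀ {e e'} → e ⟶ e' → Before k e e')
    × (∀ {e e'} → ConflictBefore k e e' → e ⇢ e')
    where open ExecutionStructure X

module _ {Proc Inv Res} (I : Occurrences Proc Inv) (R : Occurrences Proc Res) where
  private
    module I = Occurrences I
    module R = Occurrences R

  Event : Set
  Event = I.Carrier ⊎ R.Carrier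

  process : Event → Proc
  process = [ I.proc , R.proc ]′

  -- The order of a history is the strict one, so the events have to be given
  -- alongside it.
  record History : Set₁ where
    infix 4 _≺_
    field
      events  : Pred Event 0ℓ
      finite  : ∃[ xs ] (∀ {x} → x ∈ events → x ∈ₗ xs)
      _≺_     : Rel Event 0ℓ
      support : ∀ {x y} → x ≺ y → x ∈ events × y ∈ events

module _ {Proc Inv Res} {I : Occurrences Proc Inv} {R : Occurrences Proc Res} where
  private
    module I = Occurrences I
    module R = Occurrences R
    module Op = Occurrences (operations I R)
  open History

  infix 4 _≈_
  _≈_ : History I R → History I R → Set
  h ≈ h' = events h ≐ events h' × (∀ x y → _≺_ h x y ⇔ _≺_ h' x y)

  infixl 5 _↓_
  _↓_ : History I R → Proc → History I R
  h ↓ p = record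
    { events  = λ x → x ∈ events h × process I R x ≡ p
    ; finite  = proj₁ (finite h) , λ (x∈h , _) → proj₂ (finite h) x∈h
    ; _≺_     = λ x y → _≺_ h x y × process I R x ≡ p × process I R y ≡ p
    ; support = λ (x≺y , px , py) →
        (proj₁ (support h x≺y) , px) , (proj₂ (support h x≺y) , py)
    }

  PartiallyOrdered : History I R → Set
  PartiallyOrdered h = IsStrictPartialOrder _≡_ (_≺_ h)

  TotallyOrdered : History I R → Set
  TotallyOrdered h = PartiallyOrdered h ×
    (∀ {x y} → x ∈ events h → y ∈ events h → _≺_ h x y ⊎ x ≡ y ⊎ _≺_ h y x)

  ImmediatelyFollowedBy : History I R → Rel (Event I R) 0ℓ
  ImmediatelyFollowedBy h x y = _≺_ h x y × (∀ z → ¬ (_≺_ h x z × _≺_ h z y))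

  -- The response matching an invocation is the one that comes next in the
  -- same process.
  mp : History I R → Pred Op.Carrier 0ℓ
  mp h (i , r) = ImmediatelyFollowedBy (h ↓ I.proc i) (inj₁ i) (inj₂ r)

  -- Each process alternates between invocations and matching responses,
  -- beginning with an invocation; only its last invocation may be pending.
  record WellFormed (h : History I R) : Set where
    field
      partiallyOrdered : PartiallyOrdered h
      processTotal     : ∀ p → TotallyOrdered (h ↓ p)
      responseMatched  : ∀ r → inj₂ r ∈ events h → ∃[ i ] (i , r) ∈ mp h
      nonLastMatched   : ∀ i e → _≺_ (h ↓ I.proc i) (inj₁ i) e → ∃[ r ] (i , r) ∈ mp h

  Complete : History I R → Set
  Complete h = ∀ i → inj₁ i ∈ events h → ∃[ r ] (i , r) ∈ mp h

  LabelledBy : Object Inv Res → History I R → Set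
  LabelledBy S h = ∀ e → e ∈ mp h → Op.label e ∈ Object.labels S

  Sequential : History I R → Set
  Sequential h = TotallyOrdered h ×
    (∀ i → inj₁ i ∈ events h →
      ∃[ r ] (i , r) ∈ mp h × ImmediatelyFollowedBy h (inj₁ i) (inj₂ r))

  RealTime : History I R → Rel Op.Carrier 0ℓ
  RealTime h (i₁ , r₁) (i₂ , r₂) =
    (i₁ , r₁) ∈ mp h × (i₂ , r₂) ∈ mp h × _≺_ h (inj₂ r₁) (inj₁ i₂)

  -- k is the sequence γ(hs), for a sequential history hs; these conditions
  -- determine k.
  record IsγOf (hs : History I R) (k : List Op.Carrier) : Set where
    field
      unique  : Unique k
      members : ∀ e → e ∈ₗ k ⇔ e ∈ mp hs
      order   : ∀ {i r i' r'} → (i , r) ∈ mp hs → (i' , r') ∈ mp hs →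
                _≺_ hs (inj₂ r) (inj₁ i') ⇔ Before k (i , r) (i' , r')

  Linearizable : Object Inv Res → History I R → Set₁
  Linearizable S h = ∃[ hs ]
      Sequential hs
    × (∃[ k ] IsγOf hs k × Object.legal S (map Op.label k))
    × (∀ p → h ↓ p ≈ hs ↓ p)
    × (∀ {i₁ r₁ i₂ r₂} → (i₁ , r₁) ∈ mp h → (i₂ , r₂) ∈ mp h →
        _≺_ h (inj₂ r₁) (inj₁ i₂) → _≺_ hs (inj₂ r₁) (inj₁ i₂))

  exec : History I R → ExecutionStructure (operations I R)
  exec h = record
    { E   = mp h
    ; _⟶_ = RealTime h
    ; _⇢_ = λ (i₁ , r₁) (i₂ , r₂) →
        (i₁ , r₁) ∈ mp h × (i₂ , r₂) ∈ mp h × _≺_ h (inj₁ i₁) (inj₂ r₂)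
    }

{-# OPTIONS --safe #-}

-- Operations of one process never overlap, so any sequence of operations that
-- respects the real-time order also respects the order of each process, and
-- replacing each operation of the causal linearization k by its invocation
-- followed by its response yields a sequential witness.  Conversely, let e
-- come before e' in γ(hs).  Since h is total, either the invocation of e
-- precedes the response of e' in h, or e' precedes e in real time; hs excludes
-- the latter.
module Submission where

open import Defs
open import Data.Empty using (⊥-elim)
open import Data.List using (List; []; _∷_; concatMap; map)
open import Data.List.Membership.Propositional using (find; lose) renaming (_∈_ to _∈ₗ_)
open import Data.List.Membership.Propositional.Properties using (∈-concatMap⁺; ∈-concatMap⁻)
open import Data.List.Relation.Binary.Sublist.Propositional
  using (_∷_; _∷ʳ_; ⊆-refl; ⊆-trans; from∈; to∈; lookup) renaming (_⊆_ to _⊑_)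
open import Data.List.Relation.Binary.Sublist.Propositional.Properties using (++⁺; ++⁺ˡ; ++⁺ʳ)
open import Data.List.Relation.Unary.All as All using ([]; _∷_)
open import Data.List.Relation.Unary.AllPairs using ([]; _∷_)
open import Data.List.Relation.Unary.Any using (here; there)
open import Data.List.Relation.Unary.Unique.Propositional using (Unique)
open import Data.List.Relation.Unary.Unique.Propositional.Properties
  using () renaming (++⁺ to unique-++⁺)
open import Data.Product using (∃-syntax; _×_; _,_; proj₁; proj₂)
open import Data.Sum using (_⊎_; inj₁; inj₂)
open import Function.Base using (id)
open import Function.Bundles using (_⇔_; Equivalence; mk⇔)
open import Relation.Binary using (IsStrictPartialOrder)
open import Relation.Binary.PropositionalEquality
  using (_≡_; refl; sym; trans; cong; isEquivalence; resp₂)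
open import Relation.Nullary using (¬_)
open import Relation.Unary using (_∈_)

-- Order of occurrence in a duplicate-free list.

module _ {A : Set} where

  Before-∈ˡ : ∀ {xs} {x y : A} → Before xs x y → x ∈ₗ xs
  Before-∈ˡ s = lookup s (here refl)

  Before-∈ʳ : ∀ {xs} {x y : A} → Before xs x y → y ∈ₗ xs
  Before-∈ʳ s = lookup s (there (here refl))

  Before-irrefl : ∀ {xs} {x : A} → Unique xs → ¬ Before xs x x
  Before-irrefl (_ ∷ u)   (_ ∷ʳ s)   = Before-irrefl u s
  Before-irrefl (x∉ ∷ _)  (refl ∷ s) = All.lookup x∉ (to∈ s) refl

  Before-trans : ∀ {xs} {x y z : A} → Unique xs →
    Before xs x y → Before xs y z → Before xs x z
  Before-trans (_ ∷ u)  (_ ∷ʳ s)   (_ ∷ʳ t)   = _ ∷ʳ Before-trans u s t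
  Before-trans (_ ∷ u)  (refl ∷ s) (_ ∷ʳ t)   = refl ∷ from∈ (Before-∈ʳ t)
  -- Here `y` would be both the head and a member of the tail.
  Before-trans (x∉ ∷ _) (_ ∷ʳ s)   (refl ∷ t) = ⊥-elim (All.lookup x∉ (Before-∈ʳ s) refl)
  Before-trans (x∉ ∷ _) (refl ∷ s) (refl ∷ t) = refl ∷ t

  Before-isStrictPartialOrder : ∀ {xs : List A} → Unique xs →
    IsStrictPartialOrder _≡_ (Before xs)
  Before-isStrictPartialOrder u = record
    { isEquivalence = isEquivalence
    ; irrefl        = λ { refl → Before-irrefl u }
    ; trans         = Before-trans u
    ; <-resp-≈      = resp₂ _
    }

  Before-asym : ∀ {xs} {x y : A} → Unique xs → Before xs x y → ¬ Before xs y x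
  Before-asym u s t = Before-irrefl u (Before-trans u s t)

  Before-total : ∀ {xs} {x y : A} → x ∈ₗ xs → y ∈ₗ xs →
    Before xs x y ⊎ x ≡ y ⊎ Before xs y x
  Before-total (here refl) (here refl) = inj₂ (inj₁ refl)
  Before-total (here refl) (there y∈)  = inj₁ (refl ∷ from∈ y∈)
  Before-total (there x∈)  (here refl) = inj₂ (inj₂ (refl ∷ from∈ x∈))
  Before-total (there x∈)  (there y∈)  with Before-total x∈ y∈
  ... | inj₁ s        = inj₁ (_ ∷ʳ s)
  ... | inj₂ (inj₁ e) = inj₂ (inj₁ e)
  ... | inj₂ (inj₂ s) = inj₂ (inj₂ (_ ∷ʳ s))

-- Concatenation of blocks.

module _ {A B : Set} (f : A → List B) where

  ⊑-concatMap : ∀ {xs a} → a ∈ₗ xs → f a ⊑ concatMap f xs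
  ⊑-concatMap (here refl)        = ++⁺ʳ _ ⊆-refl
  ⊑-concatMap {x ∷ _} (there a∈) = ++⁺ˡ (f x) (⊑-concatMap a∈)

  Before-concatMap : ∀ {xs a b x y} → Before xs a b → x ∈ₗ f a → y ∈ₗ f b →
    Before (concatMap f xs) x y
  Before-concatMap (z ∷ʳ s)   x∈ y∈ = ++⁺ˡ (f z) (Before-concatMap s x∈ y∈)
  Before-concatMap (refl ∷ s) x∈ y∈ =
    ++⁺ (from∈ x∈) (from∈ (∈-concatMap⁺ f (lose (to∈ s) y∈)))

  -- Disjointness of blocks is asked only of members of `xs`: arbitrary pairs of events may share an
  -- invocation, whereas those matched in a total history cannot.
  concatMap-unique : ∀ {xs} → (∀ a → Unique (f a)) →
    (∀ {a b x} → a ∈ₗ xs → b ∈ₗ xs → x ∈ₗ f a → x ∈ₗ f b → a ≡ b) →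
    Unique xs → Unique (concatMap f xs)
  concatMap-unique uf inj [] = []
  concatMap-unique uf inj (x∉ ∷ u) =
    unique-++⁺ (uf _) (concatMap-unique uf (λ a∈ b∈ → inj (there a∈) (there b∈)) u)
      λ (x∈ , x∈') → let (b , b∈ , x∈b) = find (∈-concatMap⁻ f x∈') in
        All.lookup x∉ b∈ (inj (here refl) (there b∈) x∈ x∈b)

-- Matching pairs and restrictions to processes.

module _ {Proc Inv Res} {I : Occurrences Proc Inv} {R : Occurrences Proc Res} where
  private
    module I = Occurrences I
    module R = Occurrences R
    module Op = Occurrences (operations I R)

  -- Matching is decided inside the restriction to the process of the invocation, so histories that
  -- agree on every process have the same operations.
  mp-resp-≈ : ∀ {h h' : History I R} → (∀ p → h ↓ p ≈ h' ↓ p) →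
    ∀ {e} → e ∈ mp h → e ∈ mp h'
  mp-resp-≈ h≈h' {i , r} (i≺r , adj) =
    Equivalence.to (proj₂ (h≈h' _) _ _) i≺r ,
    λ z (i≺z , z≺r) → adj z
      ( Equivalence.from (proj₂ (h≈h' _) _ _) i≺z
      , Equivalence.from (proj₂ (h≈h' _) _ _) z≺r)

  ≈-sym : ∀ {h h' : History I R} → h ≈ h' → h' ≈ h
  ≈-sym ((f , g) , o) = (g , f) , λ x y →
    mk⇔ (Equivalence.from (o x y)) (Equivalence.to (o x y))

  block : Op.Carrier → List (Event I R)
  block (i , r) = inj₁ i ∷ inj₂ r ∷ []

  block-unique : ∀ e → Unique (block e)
  block-unique (i , r) = ((λ ()) ∷ []) ∷ [] ∷ []

  -- Operations of one process in a totally ordered history.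

  module _ (h : History I R) (tot : TotallyOrdered h) where
    open History h
    private module ≺ = IsStrictPartialOrder (proj₁ tot)

    mp-≺ : ∀ {i r} → (i , r) ∈ mp h → inj₁ i ≺ inj₂ r
    mp-≺ ((i≺r , _) , _) = i≺r

    mp-adjacent : ∀ {i r z} → (i , r) ∈ mp h → process I R z ≡ I.proc i →
      inj₁ i ≺ z → ¬ z ≺ inj₂ r
    mp-adjacent ((_ , refl , pr) , adj) pz i≺z z≺r =
      adj _ ((i≺z , refl , pz) , (z≺r , pz , pr))

    block-process : ∀ {e x} → e ∈ mp h → x ∈ₗ block e → process I R x ≡ Op.proc e
    block-process _                   (here refl)         = refl
    block-process ((_ , _ , pr) , _) (there (here refl)) = pr

    block-events : ∀ {e x} → e ∈ mp h → x ∈ₗ block e → x ∈ events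
    block-events m (here refl)         = proj₁ (support (mp-≺ m))
    block-events m (there (here refl)) = proj₂ (support (mp-≺ m))

    -- Operations of one process do not overlap: if `i'` preceded `r`, it would lie strictly between
    -- `i` and its matching response.
    inv-≺⇒RealTime : ∀ {i r i' r'} → (i , r) ∈ mp h → (i' , r') ∈ mp h →
      I.proc i' ≡ I.proc i → inj₁ i ≺ inj₁ i' → RealTime h (i , r) (i' , r')
    inv-≺⇒RealTime m m' p i≺i'
      with proj₂ tot (proj₂ (support (mp-≺ m))) (proj₁ (support (mp-≺ m')))
    ... | inj₁ r≺i'        = m , m' , r≺i'
    ... | inj₂ (inj₂ i'≺r) = ⊥-elim (mp-adjacent m p i≺i' i'≺r)

    -- Of two distinct responses, the earlier would separate `i` from the later one.
    mp-functional : ∀ {i r r'} → (i , r) ∈ mp h → (i , r') ∈ mp h → r ≡ r'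
    mp-functional m m'
      with proj₂ tot (proj₂ (support (mp-≺ m))) (proj₂ (support (mp-≺ m')))
    ... | inj₁ r≺r'          = ⊥-elim (mp-adjacent m' (block-process m (there (here refl))) (mp-≺ m) r≺r')
    ... | inj₂ (inj₁ refl)   = refl
    ... | inj₂ (inj₂ r'≺r)   = ⊥-elim (mp-adjacent m (block-process m' (there (here refl))) (mp-≺ m') r'≺r)

    sameProcess-total : ∀ {e e'} → e ∈ mp h → e' ∈ mp h → Op.proc e ≡ Op.proc e' →
      RealTime h e e' ⊎ e ≡ e' ⊎ RealTime h e' e
    sameProcess-total m m' p
      with proj₂ tot (proj₁ (support (mp-≺ m))) (proj₁ (support (mp-≺ m')))
    ... | inj₁ i≺i'        = inj₁ (inv-≺⇒RealTime m m' (sym p) i≺i')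
    ... | inj₂ (inj₁ refl) = inj₂ (inj₁ (cong (_ ,_) (mp-functional m m')))
    ... | inj₂ (inj₂ i'≺i) = inj₂ (inj₂ (inv-≺⇒RealTime m' m p i'≺i))

    RealTime-block : ∀ {e e' x y} → RealTime h e e' → x ∈ₗ block e → y ∈ₗ block e' → x ≺ y
    RealTime-block {i , r} {e'} (m , m' , r≺i') x∈ y∈ = left x∈ (right y∈)
      where
      right : ∀ {y} → y ∈ₗ block e' → inj₂ r ≺ y
      right (here refl)         = r≺i'
      right (there (here refl)) = ≺.trans r≺i' (mp-≺ m')
      left : ∀ {x y} → x ∈ₗ block (i , r) → inj₂ r ≺ y → x ≺ y
      left (here refl)         r≺y = ≺.trans (mp-≺ m) r≺y
      left (there (here refl)) r≺y = r≺y

    -- A shared event puts both operations in one process, where they are equal or ordered in real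
    -- time. In the latter case the shared event would precede itself.
    block-injective : ∀ {e e' x} → e ∈ mp h → e' ∈ mp h → x ∈ₗ block e → x ∈ₗ block e' → e ≡ e'
    block-injective m m' x∈ x∈'
      with sameProcess-total m m' (trans (sym (block-process m x∈)) (block-process m' x∈'))
    ... | inj₁ rt        = ⊥-elim (≺.irrefl refl (RealTime-block rt x∈ x∈'))
    ... | inj₂ (inj₁ eq) = eq
    ... | inj₂ (inj₂ rt) = ⊥-elim (≺.irrefl refl (RealTime-block rt x∈' x∈))

    block-≺⇒Before : ∀ {e x y} → e ∈ mp h → x ∈ₗ block e → y ∈ₗ block e → x ≺ y →
      Before (block e) x y
    block-≺⇒Before m (here refl)         (here refl)         x≺y = ⊥-elim (≺.irrefl refl x≺y)
    block-≺⇒Before m (here refl)         (there (here refl)) _   = ⊆-refl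
    block-≺⇒Before m (there (here refl)) (here refl)         x≺y = ⊥-elim (≺.asym x≺y (mp-≺ m))
    block-≺⇒Before m (there (here refl)) (there (here refl)) x≺y = ⊥-elim (≺.irrefl refl x≺y)

  -- From a causal linearization to a sequential history.

  module Sequentialization
    (h : History I R) (wf : WellFormed h) (complete : Complete h) (tot : TotallyOrdered h)
    (k : List Op.Carrier) (k-unique : Unique k) (k-members : ∀ e → e ∈ₗ k ⇔ e ∈ mp h)
    (realTime : ∀ {e e'} → RealTime h e e' → Before k e e')
    where
    open History h
    private module ≺ = IsStrictPartialOrder (proj₁ tot)

    ∈k⇒mp : ∀ {e} → e ∈ₗ k → e ∈ mp h
    ∈k⇒mp = Equivalence.to (k-members _)

    mp⇒∈k : ∀ {e} → e ∈ mp h → e ∈ₗ k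
    mp⇒∈k = Equivalence.from (k-members _)

    flat : List (Event I R)
    flat = concatMap block k

    flat-unique : Unique flat
    flat-unique = concatMap-unique block block-unique
      (λ e∈ e'∈ → block-injective h tot (∈k⇒mp e∈) (∈k⇒mp e'∈)) k-unique

    -- Completeness supplies the match of an invocation, well-formedness that of a response.
    owner : ∀ {x} → x ∈ events → ∃[ e ] e ∈ mp h × x ∈ₗ block e
    owner {inj₁ i} x∈h = let (r , m) = complete i x∈h in (i , r) , m , here refl
    owner {inj₂ r} x∈h =
      let (i , m) = WellFormed.responseMatched wf r x∈h in (i , r) , m , there (here refl)

    flat-owner : ∀ {x} → x ∈ₗ flat → ∃[ e ] e ∈ₗ k × x ∈ₗ block e
    flat-owner x∈ = find (∈-concatMap⁻ block x∈)

    flat⇒events : ∀ {x} → x ∈ₗ flat → x ∈ events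
    flat⇒events x∈ =
      let (_ , e∈ , x∈e) = flat-owner x∈ in block-events h tot (∈k⇒mp e∈) x∈e

    events⇒flat : ∀ {x} → x ∈ events → x ∈ₗ flat
    events⇒flat x∈ =
      let (_ , m , x∈e) = owner x∈ in ∈-concatMap⁺ block (lose (mp⇒∈k m) x∈e)

    hs : History I R
    hs = record
      { events  = _∈ₗ flat
      ; finite  = flat , id
      ; _≺_     = Before flat
      ; support = λ s → Before-∈ˡ s , Before-∈ʳ s
      }

    hs-total : TotallyOrdered hs
    hs-total = Before-isStrictPartialOrder flat-unique , Before-total

    -- The operations owning `x` and `y` share a process, so they coincide or are ordered in real
    -- time. A real-time order is inherited by `k`, and hence by all events of the two blocks.
    processOrder⇒ : ∀ {x y} → process I R x ≡ process I R y → x ≺ y → Before flat x y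
    processOrder⇒ p x≺y
      with owner (proj₁ (support x≺y)) | owner (proj₂ (support x≺y))
    ... | e , m , x∈ | e' , m' , y∈
      with sameProcess-total h tot m m'
             (trans (sym (block-process h tot m x∈)) (trans p (block-process h tot m' y∈)))
    ... | inj₁ rt          = Before-concatMap block (realTime rt) x∈ y∈
    ... | inj₂ (inj₁ refl) =
      -- Within a single operation the only possible order is invocation before response, which its
      -- block reproduces.
      ⊆-trans (block-≺⇒Before h tot m x∈ y∈ x≺y) (⊑-concatMap block (mp⇒∈k m))
    ... | inj₂ (inj₂ rt)   = ⊥-elim (≺.asym x≺y (RealTime-block h tot rt y∈ x∈))

    -- The order of `h` is total, so a failure would give `y ≺ x`, which the forward direction
    -- carries into `flat` against `s`.
    processOrder⇐ : ∀ {x y} → process I R x ≡ process I R y → Before flat x y → x ≺ y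
    processOrder⇐ p s with proj₂ tot (flat⇒events (Before-∈ˡ s)) (flat⇒events (Before-∈ʳ s))
    ... | inj₁ x≺y         = x≺y
    ... | inj₂ (inj₁ refl) = ⊥-elim (Before-irrefl flat-unique s)
    ... | inj₂ (inj₂ y≺x)  =
      ⊥-elim (Before-asym flat-unique s (processOrder⇒ (sym p) y≺x))

    h≈hs : ∀ p → h ↓ p ≈ hs ↓ p
    h≈hs p =
      ( (λ (x∈ , px) → events⇒flat x∈ , px) , (λ (x∈ , px) → flat⇒events x∈ , px)) ,
      λ x y → mk⇔
        (λ (x≺y , px , py) → processOrder⇒ (trans px (sym py)) x≺y , px , py)
        (λ (s , px , py) → processOrder⇐ (trans px (sym py)) s , px , py)

    mp⇒hs : ∀ {e} → e ∈ mp h → e ∈ mp hs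
    mp⇒hs = mp-resp-≈ {h} {hs} h≈hs

    hs⇒mp : ∀ {e} → e ∈ mp hs → e ∈ mp h
    hs⇒mp = mp-resp-≈ {hs} {h} (λ p → ≈-sym {h ↓ p} {hs ↓ p} (h≈hs p))

    block-flat : ∀ {i r} → (i , r) ∈ₗ k → Before flat (inj₁ i) (inj₂ r)
    block-flat = ⊑-concatMap block

    -- The block containing `z` lies wholly after `r`, wholly before `i`, or is the block of
    -- `(i , r)` itself, which has no third event.
    block-contiguous : ∀ {i r} → (i , r) ∈ₗ k → ∀ z →
      ¬ (Before flat (inj₁ i) z × Before flat z (inj₂ r))
    block-contiguous e∈ z (i≺z , z≺r) with flat-owner (Before-∈ʳ i≺z)
    ... | e' , e'∈ , z∈ with Before-total e∈ e'∈
    ... | inj₁ s = Before-asym flat-unique z≺r (Before-concatMap block s (there (here refl)) z∈)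
    ... | inj₂ (inj₂ s) = Before-asym flat-unique i≺z (Before-concatMap block s z∈ (here refl))
    ... | inj₂ (inj₁ refl) with z∈
    ...   | here refl         = Before-irrefl flat-unique i≺z
    ...   | there (here refl) = Before-irrefl flat-unique z≺r

    hs-sequential : Sequential hs
    hs-sequential = hs-total , λ i i∈ →
      let (r , m) = complete i (flat⇒events i∈)
          e∈      = mp⇒∈k m
      in r , mp⇒hs m , block-flat e∈ , block-contiguous e∈

    -- Any other arrangement in `k` contradicts `s`: equal operations put `i` before `r`, and
    -- reversed ones put `i'` before `r`.
    flat-order : ∀ {i r i' r'} → (i , r) ∈ₗ k → (i' , r') ∈ₗ k →
      Before flat (inj₂ r) (inj₁ i') → Before k (i , r) (i' , r')
    flat-order e∈ e'∈ s with Before-total e∈ e'∈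
    ... | inj₁ t           = t
    ... | inj₂ (inj₁ refl) = ⊥-elim (Before-asym flat-unique s (block-flat e∈))
    ... | inj₂ (inj₂ t)    =
      ⊥-elim (Before-asym flat-unique s (Before-concatMap block t (here refl) (there (here refl))))

    isγOf : IsγOf hs k
    isγOf = record
      { unique  = k-unique
      ; members = λ e → mk⇔ (λ e∈ → mp⇒hs (∈k⇒mp e∈)) (λ m → mp⇒∈k (hs⇒mp m))
      ; order   = λ m m' → mk⇔
          (flat-order (mp⇒∈k (hs⇒mp m)) (mp⇒∈k (hs⇒mp m')))
          (λ s → Before-concatMap block s (there (here refl)) (here refl))
      }

    linearizable : ∀ S → Object.legal S (map Op.label k) → Linearizable S h
    linearizable S k-legal =
      hs , hs-sequential , (k , isγOf , k-legal) , h≈hs ,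
      λ m m' r≺i → Before-concatMap block (realTime (m , m' , r≺i)) (there (here refl)) (here refl)

  -- From a linearization to a causal linearization.

  Linearizable⇒CausallyLinearizable : ∀ S {h : History I R} → TotallyOrdered h →
    Linearizable S h → CausallyLinearizable S (exec h)
  Linearizable⇒CausallyLinearizable S {h} tot
    (hs , _ , (k , γ , k-legal) , h≈hs , realTime) =
    k , γ.unique , k-legal , (λ e → mk⇔ ∈k⇒mp mp⇒∈k) , preserves ,
    λ (s , _) → ∈k⇒mp (Before-∈ˡ s) , ∈k⇒mp (Before-∈ʳ s) , inv≺res s
    where
    module γ = IsγOf γ
    open History h

    mp⇒hs : ∀ {e} → e ∈ mp h → e ∈ mp hs
    mp⇒hs = mp-resp-≈ {h} {hs} h≈hs

    ∈k⇒mp : ∀ {e} → e ∈ₗ k → e ∈ mp h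
    ∈k⇒mp e∈ = mp-resp-≈ {hs} {h} (λ p → ≈-sym {h ↓ p} {hs ↓ p} (h≈hs p))
      (Equivalence.to (γ.members _) e∈)

    mp⇒∈k : ∀ {e} → e ∈ mp h → e ∈ₗ k
    mp⇒∈k m = Equivalence.from (γ.members _) (mp⇒hs m)

    -- Real-time order passes from `h` to `hs` by linearizability, and from `hs` to `k` by the order
    -- clause of `IsγOf`.
    preserves : ∀ {e e'} → RealTime h e e' → Before k e e'
    preserves (m , m' , r≺i) =
      Equivalence.to (γ.order (mp⇒hs m) (mp⇒hs m')) (realTime m m' r≺i)

    inv≺res : ∀ {i r i' r'} → Before k (i , r) (i' , r') → inj₁ i ≺ inj₂ r'
    inv≺res s
      with m ← ∈k⇒mp (Before-∈ˡ s) | m' ← ∈k⇒mp (Before-∈ʳ s)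
      with proj₂ tot (proj₁ (support (mp-≺ h tot m))) (proj₂ (support (mp-≺ h tot m')))
    ... | inj₁ i≺r'        = i≺r'
    -- This is a real-time precedence of the second operation over the first, so `preserves` orders
    -- them in `k` oppositely to `s`.
    ... | inj₂ (inj₂ r'≺i) = ⊥-elim (Before-asym γ.unique s (preserves (m' , m , r'≺i)))

theorem12 : ∀ {Proc Inv Res : Set} (I : Occurrences Proc Inv) (R : Occurrences Proc Res)
    (S : SequentialObject Inv Res ⊎ ObjectFamily Inv Res) (h : History I R) →
    WellFormed h → Complete h → TotallyOrdered h → LabelledBy (objectOf S) h →
    Linearizable (objectOf S) h ⇔ CausallyLinearizable (objectOf S) (exec h)
theorem12 I R S h wf complete tot _ = mk⇔
  (Linearizable⇒CausallyLinearizable (objectOf S) {h} tot)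
  λ (k , k-unique , k-legal , k-members , realTime , _) →
    Sequentialization.linearizable h wf complete tot k k-unique k-members realTime
      (objectOf S) k-legal
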